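{- Let $F$ be a finite simple graph without isolated vertices, and let $G$ be a $k$-fold cover of $F$. Then $\gamma_t(G) \leq k\,\gamma_t(F)$. Moreover, this bound is tight: for every positive integer $k$ there exist a graph $F$ without isolated vertices and a $k$-fold cover $G$ of $F$ with $\gamma_t(G) = k\,\gamma_t(F)$.
   Context: All graphs are finite, simple and undirected. A graph $G$ is a cover of a graph $F$ if there is an onto map $\pi: V(G)\to V(F)$ such that for every vertex $v$ of $G$, $\pi$ maps the neighbours of $v$ in $G$ bijectively onto the neighbours of $\pi(v)$ in $F$; the cover is $k$-fold if every fibre $\pi^{ -1}(u)$ has exactly $k$ vertices. A total dominating set of a graph is a set $S$ of vertices such that every vertex of the graph (including those in $S$) is adjacent to some vertex of $S$; it exists iff the graph has no isolated vertices. $\gamma_t(\cdot)$ denotes the total domination number, the minimum size of a total dominating set. -}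

module Defs where

open import Data.Bool.Base using (true; false)
open import Data.Fin.Base using (Fin)
open import Data.Fin.Properties using (all?; any?; _≟_)
open import Data.Fin.Subset using (Subset; inside; outside; _∈_; ∣_∣; ⊤)
open import Data.Fin.Subset.Properties using (_∈?_; ∈⊤; ∣⊤∣≡n)
open import Data.List.Base using (List; []; _∷_; _++_; map; filter)
import Data.List.Extrema.Nat as Extrema
import Data.List.Membership.Propositional as Mem
open import Data.List.Membership.Propositional.Properties using (∈-map⁺; ∈-map⁻; ∈-filter⁺; ∈-filter⁻; ∈-++⁺ˡ; ∈-++⁺ʳ)
open import Data.List.Relation.Unary.All using (lookup)
open import Data.List.Relation.Unary.Any using (here)
open import Data.Nat.Base using (ℕ; zero; suc; _≤_)
open import Data.Product.Base using (∃; _×_; _,_; proj₂)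
open import Data.Sum.Base using (inj₁; inj₂)
import Data.Vec.Base as Vec
open import Function.Base using (id)
open import Level using (0ℓ)
open import Relation.Binary.Core using (Rel)
open import Relation.Binary.Definitions using (Decidable; Symmetric)
open import Relation.Binary.PropositionalEquality.Core using (_≡_; refl; sym; trans)
open import Relation.Nullary.Decidable.Core using (Dec; does; _×-dec_)
open import Relation.Nullary.Negation.Core using (¬_)

record Graph : Set₁ where
  field
    order   : ℕ
    Adj     : Rel (Fin order) 0ℓ
    adj?    : Decidable Adj
    adj-sym : Symmetric Adj
    noLoop  : ∀ v → ¬ Adj v v

  Vertex : Set
  Vertex = Fin order

open Graph public using (order; Vertex)

NoIsolatedVertices : Graph → Set
NoIsolatedVertices G = ∀ v → ∃ λ u → Graph.Adj G v u

module _ (G F : Graph) where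
  private
    module G = Graph G
    module F = Graph F

  -- Adjacency may be proof-relevant, so the bijection between neighbourhoods
  -- is spelled out on vertices rather than on pairs of a vertex and a proof.
  record IsCoveringMap (π : Vertex G → Vertex F) : Set where
    field
      onto           : ∀ u → ∃ λ v → π v ≡ u
      nbr-map        : ∀ v {w} → G.Adj v w → F.Adj (π v) (π w)
      nbr-injective  : ∀ v {w w′} → G.Adj v w → G.Adj v w′ → π w ≡ π w′ → w ≡ w′
      nbr-surjective : ∀ v {u} → F.Adj (π v) u → ∃ λ w → G.Adj v w × π w ≡ u

fibre : ∀ {m n} → (Fin m → Fin n) → Fin n → Subset m
fibre π u = Vec.tabulate λ v → does (π v ≟ u)

record FoldCover (k : ℕ) (G F : Graph) : Set where
  field
    π          : Vertex G → Vertex F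
    isCovering : IsCoveringMap G F π
    ∣fibre∣≡k  : ∀ u → ∣ fibre π u ∣ ≡ k

IsTotalDominating : (G : Graph) → Subset (order G) → Set
IsTotalDominating G S = ∀ v → ∃ λ u → u ∈ S × Graph.Adj G v u

isTotalDominating? : (G : Graph) (S : Subset (order G)) → Dec (IsTotalDominating G S)
isTotalDominating? G S = all? λ v → any? λ u → (u ∈? S) ×-dec Graph.adj? G v u

allSubsets : ∀ n → List (Subset n)
allSubsets zero    = Vec.[] ∷ []
allSubsets (suc n) = map (outside Vec.∷_) (allSubsets n) ++ map (inside Vec.∷_) (allSubsets n)

totalDominatingSizes : Graph → List ℕ
totalDominatingSizes G = map ∣_∣ (filter (isTotalDominating? G) (allSubsets (order G)))

-- The first argument of min bounds the result. It is harmless when there are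
-- no isolated vertices, since the whole vertex set is then total dominating.
-- A graph with isolated vertices gets the junk value order G.
γₜ : Graph → ℕ
γₜ G = Extrema.min (order G) (totalDominatingSizes G)

∈-allSubsets : ∀ {n} (S : Subset n) → S Mem.∈ allSubsets n
∈-allSubsets Vec.[]          = here refl
∈-allSubsets (false Vec.∷ S) = ∈-++⁺ˡ (∈-map⁺ (outside Vec.∷_) (∈-allSubsets S))
∈-allSubsets {suc n} (true Vec.∷ S) =
  ∈-++⁺ʳ (map (outside Vec.∷_) (allSubsets n)) (∈-map⁺ (inside Vec.∷_) (∈-allSubsets S))

γₜ-minimal : ∀ G S → IsTotalDominating G S → γₜ G ≤ ∣ S ∣
γₜ-minimal G S td = lookup (Extrema.min≤xs (order G) (totalDominatingSizes G))
  (∈-map⁺ ∣_∣ (∈-filter⁺ (isTotalDominating? G) (∈-allSubsets S) td))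

γₜ-attained : ∀ G → NoIsolatedVertices G → ∃ λ S → IsTotalDominating G S × ∣ S ∣ ≡ γₜ G
γₜ-attained G nonIso with Extrema.argmin-sel id (order G) (totalDominatingSizes G)
... | inj₁ γ≡n = ⊤ , (λ v → let (u , vu) = nonIso v in u , ∈⊤ , vu)
               , trans (∣⊤∣≡n (order G)) (sym γ≡n)
... | inj₂ γ∈ with ∈-map⁻ ∣_∣ γ∈
...   | S , S∈ , γ≡∣S∣ = S , proj₂ (∈-filter⁻ (isTotalDominating? G) {xs = allSubsets (order G)} S∈) , sym γ≡∣S∣

{-# OPTIONS --safe #-}

-- The bound: the preimage of a total dominating set of F is total dominating,
-- because neighbours lift along a covering map.
-- Tightness: the disjoint union of k copies of K₂ is a k-fold cover of K₂, and
-- in a perfect matching every vertex is the only one dominating its mate, so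
-- the only total dominating set is the whole vertex set.

module Submission where

open import Defs
open import Data.Bool.Base using (true; false)
open import Data.Fin.Base using (Fin; zero; suc)
open import Data.Fin.Properties using (_≟_; suc-injective)
open import Data.Fin.Subset using (Subset; _∈_; _⊆_; _∪_; ∣_∣; ⊥; ⊤)
open import Data.Fin.Subset.Properties using (∣⊥∣≡0; ∣⊤∣≡n; ∣p∣≤n; p⊆q⇒∣p∣≤∣q∣; p⊆p∪q; q⊆p∪q)
open import Data.Nat.Base using (ℕ; zero; suc; _≤_; _*_; _+_; z≤n; s≤s)
open import Data.Nat.Properties using (≤-trans; ≤-reflexive; ≤-antisym; +-mono-≤; *-comm; +-suc; m≤n⇒m≤1+n; module ≤-Reasoning)
open import Data.Product.Base using (Σ; ∃; _×_; _,_)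
open import Data.Vec.Base using ([]; _∷_; here; there)
open import Data.Vec.Properties using (lookup⇒[]=; lookup∘tabulate)
open import Function.Base using (_∘_)
open import Relation.Binary.PropositionalEquality.Core using (_≡_; refl; sym; trans; cong; subst)
open import Relation.Nullary.Decidable using (dec-true)
open import Relation.Nullary.Negation.Core using (¬_)

∣p∪q∣≤∣p∣+∣q∣ : ∀ {n} (p q : Subset n) → ∣ p ∪ q ∣ ≤ ∣ p ∣ + ∣ q ∣
∣p∪q∣≤∣p∣+∣q∣ []          []          = z≤n
∣p∪q∣≤∣p∣+∣q∣ (false ∷ p) (false ∷ q) = ∣p∪q∣≤∣p∣+∣q∣ p q
∣p∪q∣≤∣p∣+∣q∣ (false ∷ p) (true  ∷ q) =
  ≤-trans (s≤s (∣p∪q∣≤∣p∣+∣q∣ p q)) (≤-reflexive (sym (+-suc ∣ p ∣ ∣ q ∣)))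
∣p∪q∣≤∣p∣+∣q∣ (true  ∷ p) (false ∷ q) = s≤s (∣p∪q∣≤∣p∣+∣q∣ p q)
∣p∪q∣≤∣p∣+∣q∣ (true  ∷ p) (true  ∷ q) =
  s≤s (≤-trans (m≤n⇒m≤1+n (∣p∪q∣≤∣p∣+∣q∣ p q)) (≤-reflexive (sym (+-suc ∣ p ∣ ∣ q ∣))))

-- At `P = fibre π` this is the preimage of `S` under `π`, built as a union of fibres so that its
-- size can be bounded by recursion on `S`.
⋃[_]_ : ∀ {m n} → Subset n → (Fin n → Subset m) → Subset m
⋃[ []        ] P = ⊥
⋃[ false ∷ S ] P = ⋃[ S ] (P ∘ suc)
⋃[ true  ∷ S ] P = P zero ∪ ⋃[ S ] (P ∘ suc)

P⊆⋃ : ∀ {m n} {S : Subset n} (P : Fin n → Subset m) {u} → u ∈ S → P u ⊆ ⋃[ S ] P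
P⊆⋃ {S = true  ∷ S} P here        = p⊆p∪q (⋃[ S ] (P ∘ suc))
P⊆⋃ {S = false ∷ S} P (there u∈S) = P⊆⋃ (P ∘ suc) u∈S
P⊆⋃ {S = true  ∷ S} P (there u∈S) = q⊆p∪q (P zero) _ ∘ P⊆⋃ (P ∘ suc) u∈S

∣⋃∣≤∣S∣*k : ∀ {m n k} (S : Subset n) (P : Fin n → Subset m) →
            (∀ u → ∣ P u ∣ ≤ k) → ∣ ⋃[ S ] P ∣ ≤ ∣ S ∣ * k
∣⋃∣≤∣S∣*k {m} []      P bound = ≤-reflexive (∣⊥∣≡0 m)
∣⋃∣≤∣S∣*k (false ∷ S) P bound = ∣⋃∣≤∣S∣*k S (P ∘ suc) (bound ∘ suc)
∣⋃∣≤∣S∣*k (true  ∷ S) P bound = ≤-trans (∣p∪q∣≤∣p∣+∣q∣ (P zero) _)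
  (+-mono-≤ (bound zero) (∣⋃∣≤∣S∣*k S (P ∘ suc) (bound ∘ suc)))

∈-fibre : ∀ {m n} (π : Fin m → Fin n) {u} v → π v ≡ u → v ∈ fibre π u
∈-fibre π {u} v πv≡u =
  lookup⇒[]= v _ (trans (lookup∘tabulate _ v) (dec-true (π v ≟ u) πv≡u))

γₜ-cover : ∀ k F G → NoIsolatedVertices F → FoldCover k G F → γₜ G ≤ k * γₜ F
γₜ-cover k F G nonIso cover with γₜ-attained F nonIso
... | S , dominating , ∣S∣≡γₜ = begin
  γₜ G                   ≤⟨ γₜ-minimal G (⋃[ S ] fibre π) lifted ⟩
  ∣ ⋃[ S ] fibre π ∣     ≤⟨ ∣⋃∣≤∣S∣*k S (fibre π) (≤-reflexive ∘ ∣fibre∣≡k) ⟩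
  ∣ S ∣ * k              ≡⟨ *-comm ∣ S ∣ k ⟩
  k * ∣ S ∣              ≡⟨ cong (k *_) ∣S∣≡γₜ ⟩
  k * γₜ F               ∎
  where
  open ≤-Reasoning
  open FoldCover cover
  open IsCoveringMap isCovering

  lifted : IsTotalDominating G (⋃[ S ] fibre π)
  lifted v with dominating (π v)
  -- The dominator `u` of `π v` lifts to a neighbour `w` of `v`, which lies in the fibre over
  -- `u ∈ S` and hence in the preimage.
  ... | u , u∈S , πv~u with nbr-surjective v πv~u
  ...   | w , v~w , πw≡u = w , P⊆⋃ (fibre π) u∈S (∈-fibre π w πw≡u) , v~w

-- Vertices 2i and 2i+1 form the i-th copy of K₂. The order is `k * 2` because `suc k * 2` reduces
-- to `suc (suc (k * 2))`, so matching peels off one copy.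
mate : ∀ k → Fin (k * 2) → Fin (k * 2)
mate (suc k) zero          = suc zero
mate (suc k) (suc zero)    = zero
mate (suc k) (suc (suc v)) = suc (suc (mate k v))

mate-involutive : ∀ k v → mate k (mate k v) ≡ v
mate-involutive (suc k) zero          = refl
mate-involutive (suc k) (suc zero)    = refl
mate-involutive (suc k) (suc (suc v)) = cong (λ w → suc (suc w)) (mate-involutive k v)

v≢mate : ∀ k v → ¬ v ≡ mate k v
v≢mate (suc k) (suc (suc v)) eq = v≢mate k v (suc-injective (suc-injective eq))

matching : ℕ → Graph
matching k = record
  { order   = k * 2
  ; Adj     = λ v w → w ≡ mate k v
  ; adj?    = λ v w → w ≟ mate k v
  ; adj-sym = λ {v} w≡v′ → sym (trans (cong (mate k) w≡v′) (mate-involutive k v))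
  ; noLoop  = v≢mate k
  }

matching-nonIsolated : ∀ k → NoIsolatedVertices (matching k)
matching-nonIsolated k v = mate k v , refl

γₜ-matching : ∀ k → γₜ (matching k) ≡ k * 2
γₜ-matching k with γₜ-attained (matching k) (matching-nonIsolated k)
... | S , dominating , ∣S∣≡γₜ = trans (sym ∣S∣≡γₜ) (≤-antisym (∣p∣≤n S)
  (subst (_≤ ∣ S ∣) (∣⊤∣≡n (k * 2)) (p⊆q⇒∣p∣≤∣q∣ {p = ⊤} λ {v} _ → everything v)))
  where
  everything : ∀ v → v ∈ S
  -- Domination is applied at the mate of `v`: its only neighbour is `v`, so its dominator in `S`
  -- must be `v`.
  everything v with dominating (mate k v)
  ... | u , u∈S , u≡v″ = subst (_∈ S) (trans u≡v″ (mate-involutive k v)) u∈S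

-- Parity of the vertex: each copy of K₂ is laid over the single edge of `matching 1`.
side : ∀ k → Fin (k * 2) → Fin (1 * 2)
side (suc k) zero          = zero
side (suc k) (suc zero)    = suc zero
side (suc k) (suc (suc v)) = side k v

-- Neighbourhoods are singletons, so commuting with `mate` is what makes `side` a local bijection.
side-mate : ∀ k v → side k (mate k v) ≡ mate 1 (side k v)
side-mate (suc k) zero          = refl
side-mate (suc k) (suc zero)    = refl
side-mate (suc k) (suc (suc v)) = side-mate k v

side-onto : ∀ k u → ∃ λ v → side (suc k) v ≡ u
side-onto k zero       = zero , refl
side-onto k (suc zero) = suc zero , refl

-- Each copy of K₂ contributes exactly one vertex to either fibre.
∣fibre-side∣≡k : ∀ k u → ∣ fibre (side k) u ∣ ≡ k
∣fibre-side∣≡k zero    u          = refl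
∣fibre-side∣≡k (suc k) zero       = cong suc (∣fibre-side∣≡k k zero)
∣fibre-side∣≡k (suc k) (suc zero) = cong suc (∣fibre-side∣≡k k (suc zero))

matching-cover : ∀ k → FoldCover (suc k) (matching (suc k)) (matching 1)
matching-cover k = record
  { π          = side (suc k)
  ; isCovering = record
    { onto           = side-onto k
    ; nbr-map        = λ v w≡v′ → trans (cong (side (suc k)) w≡v′) (side-mate (suc k) v)
    ; nbr-injective  = λ v w≡v′ x≡v′ _ → trans w≡v′ (sym x≡v′)
    ; nbr-surjective = λ v u≡πv′ → mate (suc k) v , refl , trans (side-mate (suc k) v) (sym u≡πv′)
    }
  ; ∣fibre∣≡k  = ∣fibre-side∣≡k (suc k)
  }

theorem2p9 : ((k : ℕ) (F G : Graph) → NoIsolatedVertices F → FoldCover k G F → γₜ G ≤ k * γₜ F)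
    ×
    ((k : ℕ) → 1 ≤ k →
    Σ Graph λ F → Σ Graph λ G →
    -- excludes the null graph, for which the equality is vacuous (0 = k * 0)
    1 ≤ order F × NoIsolatedVertices F × FoldCover k G F × γₜ G ≡ k * γₜ F)
theorem2p9 = γₜ-cover , λ where
  (suc k) _ → matching 1 , matching (suc k) , s≤s z≤n , matching-nonIsolated 1 , matching-cover k
            -- Both sides equal `suc k * 2`, since `γₜ (matching 1)` is `1 * 2`, which reduces to 2.
            , trans (γₜ-matching (suc k)) (cong (suc k *_) (sym (γₜ-matching 1)))
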